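{- Let $D$ be a continuous dcpo with a basis $B$. Each of the following four conditions on $B$ implies that $\{\{x\in D\mid b\ll x\}\mid b\in B\}$ is a $\lnot\lnot$-stable basis for the Scott topology on $D$: (i) for every $a,b\in B$, if $\lnot\lnot(a\ll b)$, then $a\ll b$; (ii) for every $a,b\in B$, if $\lnot\lnot(a\sqsubseteq b)$, then $a\sqsubseteq b$; (iii) for every $a,b\in B$, it is decidable whether $a\ll b$; (iv) for every $a,b\in B$, it is decidable whether $a\sqsubseteq b$. Hence, if one of these conditions holds, then the Scott topology on $D$ coincides with the apartness topology on $D$ with respect to the intrinsic apartness, i.e. a subset of $D$ is Scott open if and only if it is nearly open.
   Context: Everything is constructive: neither excluded middle nor choice is assumed. A proposition $P$ is decidable if $P\vee\lnot P$ holds. A subset $S$ of a poset is directed if it is inhabited and any two elements of $S$ have an upper bound in $S$. A dcpo is a poset $(D,\sqsubseteq)$ in which every directed subset $S$ has a supremum $\bigsqcup S$. Write $x\ll y$ ($x$ is way below $y$) if for every directed $S$ with $y\sqsubseteq\bigsqcup S$ there is $s\in S$ with $x\sqsubseteq s$. $D$ is continuous if for every $x$ the set $\{y\in D\mid y\ll x\}$ is directed with supremum $x$. A basis of a dcpo $D$ is a subset $B\subseteq D$ such that for every $x\in D$ the set $\{b\in B\mid b\ll x\}$ is directed with supremum $x$. A subset $U\subseteq D$ is Scott open if it is an upper set and whenever $\bigsqcup S\in U$ with $S$ directed, some $s\in S$ is in $U$. The intrinsic apartness on $D$: $x\mathrel{\#}y$ if there is a Scott open set containing $x$ but not $y$,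 or a Scott open set containing $y$ but not $x$. For a topological space $X$ with an apartness $\#$ (an irreflexive symmetric relation) and $A\subseteq X$: the logical complement is $\lnot A=\{x\in X\mid x\notin A\}$; the complement is ${\sim}A=\{x\in X\mid\forall_{y\in A}\,x\mathrel{\#}y\}$; the interior $Y^\circ$ of $Y$ is the largest open set contained in $Y$; the apartness complement is $-A=({\sim}A)^\circ$. Subsets of the form $-A$ are called nearly open; the apartness topology on $X$ is the topology whose basic opens are the nearly open subsets of $X$. A basis $\mathcal B$ of the topology of $X$ is $\lnot\lnot$-stable if $U=(\lnot\lnot U)^\circ$ for every $U\in\mathcal B$.
   Formalization: The final clause is stated as "Scott open iff open in the apartness topology", i.e. a union of nearly open subsets; read literally, with every Scott open set a single −A, it would yield excluded middle already for the one-point dcpo. -}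

module Defs where

open import Level using (Level; _⊔_; suc)
open import Data.Product using (Σ; Σ-syntax; ∃-syntax; _×_; proj₁)
open import Data.Sum using (_⊎_)
open import Function.Bundles using (_⇔_)
open import Relation.Binary.Bundles using (Poset)
open import Relation.Unary using (Pred; _∈_; _∉_; _⊆_; _≐_; ∁)

-- Propositions are types, subsets are predicates, and sets that the
-- mathematics treats as "small" live in a fixed universe Set ℓ.
--
-- A directed subset S is presented by a family α : I → D with I : Set ℓ whose
-- range is S.  If D : Set ℓ and S : Pred D ℓ then the inclusion Σ D S → D is
-- such a family, so over an impredicative Set ℓ this is the same as quantifying
-- over all directed subsets.  Using families allows the carrier to be larger
-- than ℓ; predicatively, a dcpo with a carrier in Set ℓ would be a degenerate
-- case.

module _ {c ℓ₁ ℓ₂} (P : Poset c ℓ₁ ℓ₂) where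
  open Poset P using (Carrier) renaming (_≤_ to _⊑_)

  IsDirected : ∀ {i} {I : Set i} → (I → Carrier) → Set (i ⊔ ℓ₂)
  IsDirected {I = I} α = I × (∀ i j → ∃[ k ] α i ⊑ α k × α j ⊑ α k)

  IsSupremum : ∀ {i} {I : Set i} → (I → Carrier) → Carrier → Set (c ⊔ i ⊔ ℓ₂)
  IsSupremum α x = (∀ i → α i ⊑ x) × (∀ y → (∀ i → α i ⊑ y) → x ⊑ y)

record DCPO c ℓ₁ ℓ₂ ℓ : Set (suc (c ⊔ ℓ₁ ⊔ ℓ₂ ⊔ ℓ)) where
  field
    poset        : Poset c ℓ₁ ℓ₂
  open Poset poset public using (Carrier) renaming (_≤_ to _⊑_)
  field
    ⨆            : {I : Set ℓ} (α : I → Carrier) → IsDirected poset α → Carrier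
    ⨆-isSupremum : {I : Set ℓ} (α : I → Carrier) (δ : IsDirected poset α) →
                   IsSupremum poset α (⨆ α δ)

-- P has a logically equivalent copy in Set ℓ.
Small : ∀ {p} (ℓ : Level) → Set p → Set (p ⊔ suc ℓ)
Small ℓ P = Σ[ Q ∈ Set ℓ ] (Q ⇔ P)

module Domain {c ℓ₁ ℓ₂ ℓ} (D : DCPO c ℓ₁ ℓ₂ ℓ) where
  open DCPO D public

  infix 4 _≪_ _#_
  infix 8 _°

  _≪_ : Carrier → Carrier → Set (c ⊔ ℓ₂ ⊔ suc ℓ)
  x ≪ y = {I : Set ℓ} (α : I → Carrier) (δ : IsDirected poset α) →
          y ⊑ ⨆ α δ → ∃[ i ] x ⊑ α i

  IsContinuous : Set (c ⊔ ℓ₂ ⊔ suc ℓ)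
  IsContinuous = ∀ x →
    let ↡x : Σ Carrier (λ y → y ≪ x) → Carrier
        ↡x = proj₁
    in IsDirected poset ↡x × IsSupremum poset ↡x x

  -- The subset B is the range of β.
  IsBasis : {B : Set ℓ} → (B → Carrier) → Set (c ⊔ ℓ₂ ⊔ suc ℓ)
  IsBasis {B} β = ∀ x →
    let ↡ᴮx : Σ B (λ b → β b ≪ x) → Carrier
        ↡ᴮx = λ p → β (proj₁ p)
    in IsDirected poset ↡ᴮx × IsSupremum poset ↡ᴮx x

  -- As _≪_ quantifies over Set ℓ, the family {b ∈ B ∣ b ≪ x} is not indexed by
  -- a type in Set ℓ, so the completeness of D says nothing about it unless
  -- b ≪ x has a copy in Set ℓ.  With an impredicative notion of subset such a
  -- copy always exists.
  IsLocallySmall : {B : Set ℓ} → (B → Carrier) → Set (c ⊔ ℓ₂ ⊔ suc ℓ)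
  IsLocallySmall β = ∀ b x → Small ℓ (β b ≪ x)

  ↟ : Carrier → Pred Carrier (c ⊔ ℓ₂ ⊔ suc ℓ)
  ↟ b x = b ≪ x

  IsScottOpen : ∀ {p} → Pred Carrier p → Set (c ⊔ ℓ₂ ⊔ suc ℓ ⊔ p)
  IsScottOpen U =
    (∀ {x y} → x ⊑ y → x ∈ U → y ∈ U) ×
    ({I : Set ℓ} (α : I → Carrier) (δ : IsDirected poset α) →
     ⨆ α δ ∈ U → ∃[ i ] α i ∈ U)

  _#_ : Carrier → Carrier → Set (c ⊔ ℓ₂ ⊔ suc ℓ)
  x # y = (Σ[ U ∈ Pred Carrier ℓ ] IsScottOpen U × x ∈ U × y ∉ U)
        ⊎ (Σ[ U ∈ Pred Carrier ℓ ] IsScottOpen U × y ∈ U × x ∉ U)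

  -- The largest open subset of Y, as the union of all open subsets of Y.
  _° : ∀ {p} → Pred Carrier p → Pred Carrier (c ⊔ ℓ₂ ⊔ suc ℓ ⊔ p)
  (Y °) x = Σ[ U ∈ Pred Carrier ℓ ] IsScottOpen U × U ⊆ Y × x ∈ U

  -- The logical complement ¬ A is ∁ A.
  ∼_ : ∀ {p} → Pred Carrier p → Pred Carrier (c ⊔ ℓ₂ ⊔ suc ℓ ⊔ p)
  (∼ A) x = ∀ {y} → y ∈ A → x # y

  -- The nearly open subsets are those of the form − A.
  −_ : ∀ {p} → Pred Carrier p → Pred Carrier (c ⊔ ℓ₂ ⊔ suc ℓ ⊔ p)
  − A = (∼ A) °

  -- Open for the topology with the nearly open subsets as basic opens, i.e.
  -- a union of nearly open subsets.  Being nearly open itself is more than this: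
  -- for any proposition Q the constant subset {x ∣ Q} is a union of copies of
  -- D = − ∅, but if D is inhabited and {x ∣ Q} is of the form − A, then ¬ ¬ Q
  -- implies Q.
  IsApartnessOpen : ∀ {p} → Pred Carrier p → Set (c ⊔ ℓ₂ ⊔ suc ℓ ⊔ p)
  IsApartnessOpen W = ∀ {x} → x ∈ W →
    Σ[ A ∈ Pred Carrier ℓ ] x ∈ (− A) × (− A) ⊆ W

  module _ {p} {B : Set ℓ} (𝓑 : B → Pred Carrier p) where

    IsScottBasis : Set (c ⊔ ℓ₂ ⊔ suc ℓ ⊔ p)
    IsScottBasis =
      (∀ b → IsScottOpen (𝓑 b)) ×
      (∀ (U : Pred Carrier ℓ) → IsScottOpen U →
       ∀ {x} → x ∈ U → ∃[ b ] x ∈ 𝓑 b × 𝓑 b ⊆ U)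

    Is¬¬Stable : Set (c ⊔ ℓ₂ ⊔ suc ℓ ⊔ p)
    Is¬¬Stable = ∀ b → 𝓑 b ≐ (∁ (∁ (𝓑 b))) °

{-# OPTIONS --safe #-}
-- Let V be Scott open with V ⊆ ¬¬↟b, and x ∈ V.  Then V contains some a ≪ x
-- from the basis, so ¬¬(b ≪ a), and a fortiori ¬¬(b ⊑ a).  Stability of ≪ or of
-- ⊑ on the basis removes the double negation at a, and either result gives
-- b ≪ x.  For the apartness topology, ↟b lies inside −(¬↟b), and −(¬↟b) lies
-- inside (¬¬↟b)° because # is irreflexive, so the two agree by ¬¬-stability.
module Submission where

open import Defs
open import Level using (Level; Lift; lift)
open import Data.Product using (Σ; Σ-syntax; ∃-syntax; _×_; _,_; proj₁; proj₂)
open import Data.Sum using (_⊎_; inj₁; inj₂)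
open import Data.Unit using (⊤; tt)
open import Function.Bundles using (_⇔_; mk⇔; Equivalence)
open import Relation.Binary.Bundles using (Poset)
open import Relation.Nullary using (¬_; Dec)
open import Relation.Nullary.Decidable using (decidable-stable)
open import Relation.Unary using (Pred; _∈_; _⊆_; ∁)

module WayBelow {c ℓ₁ ℓ₂ ℓ} (D : DCPO c ℓ₁ ℓ₂ ℓ) where
  open Domain D
  private module P = Poset poset

  ⊑-≪-trans : ∀ {x y z} → x ⊑ y → y ≪ z → x ≪ z
  ⊑-≪-trans x⊑y y≪z α δ z⊑⨆ with y≪z α δ z⊑⨆
  ... | i , y⊑αi = i , P.trans x⊑y y⊑αi

  ≪-⊑-trans : ∀ {x y z} → x ≪ y → y ⊑ z → x ≪ z
  ≪-⊑-trans x≪y y⊑z α δ z⊑⨆ = x≪y α δ (P.trans y⊑z z⊑⨆)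

  ≪⇒⊑ : ∀ {x y} → x ≪ y → x ⊑ y
  ≪⇒⊑ {x} {y} x≪y = proj₂ (x≪y α δ (proj₁ (⨆-isSupremum α δ) (lift tt)))
    where
    -- The constant family at `y`, with the one-point index raised to level `ℓ`.
    α : Lift ℓ ⊤ → Carrier
    α _ = y
    δ : IsDirected poset α
    δ = lift tt , λ _ _ → lift tt , P.refl , P.refl

  #-irrefl : ∀ {x} → ¬ (x # x)
  #-irrefl (inj₁ (_ , _ , x∈U , x∉U)) = x∉U x∈U
  #-irrefl (inj₂ (_ , _ , x∈U , x∉U)) = x∉U x∈U

  -- Each `− A` is a union of Scott opens: the open set that witnesses membership of one point
  -- serves for the other point too.
  apartnessOpen⇒scottOpen : ∀ {p} {W : Pred Carrier p} →
                            IsApartnessOpen W → IsScottOpen W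
  apartnessOpen⇒scottOpen {W = W} W-open = upper , inaccessible
    where
    upper : ∀ {x y} → x ⊑ y → x ∈ W → y ∈ W
    upper x⊑y x∈W with W-open x∈W
    ... | _ , (U , U-open , U⊆∼A , x∈U) , −A⊆W =
      −A⊆W (U , U-open , U⊆∼A , proj₁ U-open x⊑y x∈U)

    inaccessible : {I : Set ℓ} (α : I → Carrier) (δ : IsDirected poset α) →
                   ⨆ α δ ∈ W → ∃[ i ] α i ∈ W
    inaccessible α δ ⨆∈W with W-open ⨆∈W
    ... | _ , (U , U-open , U⊆∼A , ⨆∈U) , −A⊆W with proj₂ U-open α δ ⨆∈U
    ... | i , αi∈U = i , −A⊆W (U , U-open , U⊆∼A , αi∈U)

module SmallBasis {c ℓ₁ ℓ₂ ℓ} (D : DCPO c ℓ₁ ℓ₂ ℓ)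
                  {B : Set ℓ} (β : B → DCPO.Carrier D)
                  (basis : Domain.IsBasis D β) (small : Domain.IsLocallySmall D β) where
  open Domain D
  open WayBelow D
  private module P = Poset poset

  infix 4 _≪ˢ_
  -- The copy in `Set ℓ` lets families indexed by basis elements way below a point have suprema in
  -- `D`.
  _≪ˢ_ : B → Carrier → Set ℓ
  b ≪ˢ x = proj₁ (small b x)

  ≪ˢ⇒≪ : ∀ {b x} → b ≪ˢ x → β b ≪ x
  ≪ˢ⇒≪ {b} {x} = Equivalence.to (proj₂ (small b x))

  ≪⇒≪ˢ : ∀ {b x} → β b ≪ x → b ≪ˢ x
  ≪⇒≪ˢ {b} {x} = Equivalence.from (proj₂ (small b x))

  inhabited : ∀ x → ∃[ b ] b ≪ˢ x
  inhabited x with proj₁ (proj₁ (basis x))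
  ... | b , b≪x = b , ≪⇒≪ˢ b≪x

  upperBound : ∀ {x a b} → a ≪ˢ x → b ≪ˢ x →
               ∃[ d ] d ≪ˢ x × β a ⊑ β d × β b ⊑ β d
  upperBound {x} {a} {b} a≪x b≪x
    with proj₂ (proj₁ (basis x)) (a , ≪ˢ⇒≪ a≪x) (b , ≪ˢ⇒≪ b≪x)
  ... | (d , d≪x) , a⊑d , b⊑d = d , ≪⇒≪ˢ d≪x , a⊑d , b⊑d

  least : ∀ {x y} → (∀ b → b ≪ˢ x → β b ⊑ y) → x ⊑ y
  least {x} {y} bound =
    proj₂ (proj₂ (basis x)) y λ (b , b≪x) → bound b (≪⇒≪ˢ b≪x)

  -- The family of all a with a ≪ a′ ≪ x for some a′ is directed with supremum
  -- above x, so each y ≪ x lies below one of its members.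
  interpolation : ∀ {y x} → y ≪ x → ∃[ b ] y ≪ β b × b ≪ˢ x
  interpolation {y} {x} y≪x with y≪x α δ x⊑⨆
    where
    I : Set ℓ
    I = Σ[ a ∈ B ] Σ[ a′ ∈ B ] (a ≪ˢ β a′) × (a′ ≪ˢ x)

    α : I → Carrier
    α (a , _) = β a

    α-inhabited : I
    α-inhabited with inhabited x
    ... | a′ , a′≪x with inhabited (β a′)
    ... | a , a≪a′ = a , a′ , a≪a′ , a′≪x

    α-upperBound : ∀ i j → ∃[ k ] α i ⊑ α k × α j ⊑ α k
    -- Bound the outer elements first: `a` and `b` are then both way below `d′`, where a second
    -- bound exists.
    α-upperBound (a , a′ , a≪a′ , a′≪x) (b , b′ , b≪b′ , b′≪x)
      with upperBound a′≪x b′≪x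
    ... | d′ , d′≪x , a′⊑d′ , b′⊑d′
      with upperBound (≪⇒≪ˢ (≪-⊑-trans (≪ˢ⇒≪ a≪a′) a′⊑d′))
                      (≪⇒≪ˢ (≪-⊑-trans (≪ˢ⇒≪ b≪b′) b′⊑d′))
    ... | d , d≪d′ , a⊑d , b⊑d = (d , d′ , d≪d′ , d′≪x) , a⊑d , b⊑d

    δ : IsDirected poset α
    δ = α-inhabited , α-upperBound

    x⊑⨆ : x ⊑ ⨆ α δ
    x⊑⨆ = least λ a′ a′≪x → least λ a a≪a′ →
      proj₁ (⨆-isSupremum α δ) (a , a′ , a≪a′ , a′≪x)
  ... | (a , a′ , a≪a′ , a′≪x) , y⊑a = a′ , ⊑-≪-trans y⊑a (≪ˢ⇒≪ a≪a′) , a′≪x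

  -- Applying `x ≪ ⨆ α δ` directly gives only `x ⊑ α i`; a basis element interpolated between them
  -- keeps the relation strict.
  ↟-isScottOpen : ∀ x → IsScottOpen (↟ x)
  ↟-isScottOpen x = (λ y⊑z x≪y → ≪-⊑-trans x≪y y⊑z) , inaccessible
    where
    inaccessible : {I : Set ℓ} (α : I → Carrier) (δ : IsDirected poset α) →
                   ⨆ α δ ∈ ↟ x → ∃[ i ] α i ∈ ↟ x
    inaccessible α δ x≪⨆ with interpolation x≪⨆
    ... | b , x≪b , b≪⨆ with ≪ˢ⇒≪ b≪⨆ α δ P.refl
    ... | i , b⊑αi = i , ≪-⊑-trans x≪b b⊑αi

  -- `_#_` and `_°` range over open sets in `Pred Carrier ℓ`, and `↟ (β b)` lives in a larger
  -- universe, so this copy is the witness.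
  ↟ˢ : B → Pred Carrier ℓ
  ↟ˢ b x = b ≪ˢ x

  ↟ˢ-isScottOpen : ∀ b → IsScottOpen (↟ˢ b)
  ↟ˢ-isScottOpen b =
    (λ x⊑y b≪x → ≪⇒≪ˢ (proj₁ (↟-isScottOpen (β b)) x⊑y (≪ˢ⇒≪ b≪x))) ,
    inaccessible
    where
    inaccessible : {I : Set ℓ} (α : I → Carrier) (δ : IsDirected poset α) →
                   ⨆ α δ ∈ ↟ˢ b → ∃[ i ] α i ∈ ↟ˢ b
    inaccessible α δ b≪⨆ with proj₂ (↟-isScottOpen (β b)) α δ (≪ˢ⇒≪ b≪⨆)
    ... | i , b≪αi = i , ≪⇒≪ˢ b≪αi

  -- The basis elements way below `x` form a directed family whose supremum lies above `x`, hence in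
  -- `U`; so `U` already contains a member of the family.
  basisElement∈ : ∀ {p} {U : Pred Carrier p} → IsScottOpen U →
                  ∀ {x} → x ∈ U → ∃[ b ] β b ∈ U × b ≪ˢ x
  basisElement∈ U-open {x} x∈U
    with proj₂ U-open α δ (proj₁ U-open x⊑⨆ x∈U)
    where
    α : Σ B (λ b → b ≪ˢ x) → Carrier
    α (b , _) = β b

    α-upperBound : ∀ i j → ∃[ k ] α i ⊑ α k × α j ⊑ α k
    α-upperBound (a , a≪x) (b , b≪x) with upperBound a≪x b≪x
    ... | d , d≪x , a⊑d , b⊑d = (d , d≪x) , a⊑d , b⊑d

    δ : IsDirected poset α
    δ = inhabited x , α-upperBound

    x⊑⨆ : x ⊑ ⨆ α δ
    x⊑⨆ = least λ b b≪x → proj₁ (⨆-isSupremum α δ) (b , b≪x)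
  ... | (b , b≪x) , b∈U = b , b∈U , b≪x

  ↟⊆ : ∀ {p} {U : Pred Carrier p} → IsScottOpen U →
       ∀ {x} → x ∈ U → ↟ x ⊆ U
  ↟⊆ U-open x∈U x≪y = proj₁ U-open (≪⇒⊑ x≪y) x∈U

  ↟-isScottBasis : IsScottBasis (λ b → ↟ (β b))
  ↟-isScottBasis = (λ b → ↟-isScottOpen (β b)) , refine
    where
    refine : ∀ (U : Pred Carrier ℓ) → IsScottOpen U →
             ∀ {x} → x ∈ U → ∃[ b ] x ∈ ↟ (β b) × ↟ (β b) ⊆ U
    refine U U-open x∈U with basisElement∈ U-open x∈U
    ... | b , b∈U , b≪x = b , ≪ˢ⇒≪ b≪x , ↟⊆ U-open b∈U

  ↟⊆[¬¬↟]° : ∀ b → ↟ (β b) ⊆ (∁ (∁ (↟ (β b)))) °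
  ↟⊆[¬¬↟]° b b≪x =
    ↟ˢ b , ↟ˢ-isScottOpen b , (λ b≪y b≪̸y → b≪̸y (≪ˢ⇒≪ b≪y)) , ≪⇒≪ˢ b≪x

  ≪-stable⇒¬¬stable : (∀ a b → ¬ ¬ (β a ≪ β b) → β a ≪ β b) →
                      Is¬¬Stable (λ b → ↟ (β b))
  ≪-stable⇒¬¬stable stable b = ↟⊆[¬¬↟]° b , [¬¬↟]°⊆↟
    where
    [¬¬↟]°⊆↟ : (∁ (∁ (↟ (β b)))) ° ⊆ ↟ (β b)
    [¬¬↟]°⊆↟ (V , V-open , V⊆¬¬↟b , x∈V) with basisElement∈ V-open x∈V
    ... | a , a∈V , a≪x =
      -- Stability applies because `a`, unlike `x`, comes from the basis.
      ≪-⊑-trans (stable b a (V⊆¬¬↟b a∈V)) (≪⇒⊑ (≪ˢ⇒≪ a≪x))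

  ⊑-stable⇒¬¬stable : (∀ a b → ¬ ¬ (β a ⊑ β b) → β a ⊑ β b) →
                      Is¬¬Stable (λ b → ↟ (β b))
  ⊑-stable⇒¬¬stable stable b = ↟⊆[¬¬↟]° b , [¬¬↟]°⊆↟
    where
    [¬¬↟]°⊆↟ : (∁ (∁ (↟ (β b)))) ° ⊆ ↟ (β b)
    [¬¬↟]°⊆↟ (V , V-open , V⊆¬¬↟b , x∈V) with basisElement∈ V-open x∈V
    ... | a , a∈V , a≪x =
      -- Weakening to `⊑` at `a` costs nothing, as `a ≪ x` restores strictness.
      ⊑-≪-trans
        (stable b a λ b⋢a → V⊆¬¬↟b a∈V λ b≪a → b⋢a (≪⇒⊑ b≪a))
        (≪ˢ⇒≪ a≪x)

  scottOpen⇒apartnessOpen : Is¬¬Stable (λ b → ↟ (β b)) →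
                            ∀ {p} {U : Pred Carrier p} →
                            IsScottOpen U → IsApartnessOpen U
  scottOpen⇒apartnessOpen stable {U = U} U-open x∈U
    with basisElement∈ U-open x∈U
  ... | b , b∈U , b≪x =
    ∁ (↟ˢ b) , (↟ˢ b , ↟ˢ-isScottOpen b , ↟ˢ⊆∼∁↟ˢ , b≪x) , −∁↟ˢ⊆U
    where
    ↟ˢ⊆∼∁↟ˢ : ↟ˢ b ⊆ ∼ ∁ (↟ˢ b)
    ↟ˢ⊆∼∁↟ˢ b≪y b≪̸z = inj₁ (↟ˢ b , ↟ˢ-isScottOpen b , b≪y , b≪̸z)

    −∁↟ˢ⊆U : (− ∁ (↟ˢ b)) ⊆ U
    −∁↟ˢ⊆U (V , V-open , V⊆∼∁↟ˢ , y∈V) =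
      ↟⊆ U-open b∈U (proj₂ (stable b) (V , V-open , V⊆¬¬↟ , y∈V))
      where
      V⊆¬¬↟ : V ⊆ ∁ (∁ (↟ (β b)))
      -- If `v` were outside `↟ (β b)`, it would lie in the set from which all of `V` is apart,
      -- giving `v # v`.
      V⊆¬¬↟ v∈V b≪̸v = #-irrefl (V⊆∼∁↟ˢ v∈V λ b≪v → b≪̸v (≪ˢ⇒≪ b≪v))

theorem4p8 : ∀ {c ℓ₁ ℓ₂ ℓ p : Level} (D : DCPO c ℓ₁ ℓ₂ ℓ) → let open Domain D in
    IsContinuous →
    {B : Set ℓ} (β : B → Carrier) → IsBasis β → IsLocallySmall β →
    ( (∀ a b → ¬ ¬ (β a ≪ β b) → β a ≪ β b)
    ⊎ (∀ a b → ¬ ¬ (β a ⊑ β b) → β a ⊑ β b)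
    ⊎ (∀ a b → Dec (β a ≪ β b))
    ⊎ (∀ a b → Dec (β a ⊑ β b)) ) →
    ( IsScottBasis (λ b → ↟ (β b)) × Is¬¬Stable (λ b → ↟ (β b)) )
    × (∀ (U : Pred Carrier p) → IsScottOpen U ⇔ IsApartnessOpen U)
theorem4p8 D _ β basis small conditions =
  (↟-isScottBasis , stable conditions) ,
  λ U → mk⇔ (scottOpen⇒apartnessOpen (stable conditions)) apartnessOpen⇒scottOpen
  where
  open Domain D
  open WayBelow D
  open SmallBasis D β basis small

  stable : (∀ a b → ¬ ¬ (β a ≪ β b) → β a ≪ β b)
         ⊎ (∀ a b → ¬ ¬ (β a ⊑ β b) → β a ⊑ β b)
         ⊎ (∀ a b → Dec (β a ≪ β b))
         ⊎ (∀ a b → Dec (β a ⊑ β b)) →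
           Is¬¬Stable (λ b → ↟ (β b))
  stable (inj₁ ≪-stable)               = ≪-stable⇒¬¬stable ≪-stable
  stable (inj₂ (inj₁ ⊑-stable))        = ⊑-stable⇒¬¬stable ⊑-stable
  -- Decidable propositions are stable under double negation, so the last two conditions reduce to
  -- the first two.
  stable (inj₂ (inj₂ (inj₁ _≪?_)))     =
    ≪-stable⇒¬¬stable λ a b → decidable-stable (a ≪? b)
  stable (inj₂ (inj₂ (inj₂ _⊑?_)))     =
    ⊑-stable⇒¬¬stable λ a b → decidable-stable (a ⊑? b)
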